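{- Fix $k,\ell \in \mathbb{N}$. Then there exist real numbers $m,M > 0$ such that $$m\, \ell^{\,n/k} \leq \boldsymbol{q}_{k}(\mathcal{T}_\ell(n)) \leq f_{k,\ell}(n) \leq M\, \ell^{\,n/k}$$ for all $n \in \mathbb{N}$, where $$f_{k,\ell}(n) := \sum_{i=0}^{\lceil n/k \rceil-1} \ell^i + \sum_{j=1}^{k-1} \ell^{\lceil (n-j)/k\rceil}.$$ Thus $\boldsymbol{q}_{k}(\mathcal{T}_\ell(n)) = \Theta(\ell^{\,n/k})$ and $f_{k,\ell}(n)=\Theta(\ell^{\,n/k})$ as functions of $n$.
   Context: $\mathbb{N}=\mathbb{Z}_{>0}$. $\mathcal{T}_\ell(n)$ denotes the complete $\ell$-ary tree of height $n$, as a poset with the root as its unique minimal element: it has exactly $\ell^{t-1}$ nodes at level $t$ for each $t\in\{1,\dots,n\}$, every node at level less than $n$ is covered by exactly $\ell$ nodes, and the set of elements below any given node is a chain. For a finite poset $\lambda$ and $v\in\lambda$, let $\lambda_{\preccurlyeq v}=\{u\in\lambda\mid u\preccurlyeq v\}$. An ideal of $\lambda$ is a subset equal to $\varnothing$ or to $\lambda_{\preccurlyeq v}$ for some $v\in\lambda$. Hidden ideal problem: $\lambda$ is known and $\mu$ is an unknown (possibly empty) ideal of $\lambda$. One sequentially (adaptively) queries elements $v\in\lambda$, learning whether $v\in\mu$ (positive) or $v\notin\mu$ (negative), under the restriction that at most $k$ positive query results are permitted. $\boldsymbol{q}_k(\lambda)$ is the minimum total number of queries needed to guarantee identification of $\mu$: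 i.e. the least $N$ such that some adaptive query strategy, for every ideal $\mu$ of $\lambda$, identifies $\mu$ using at most $N$ queries in total, at most $k$ of which are positive.
   Formalization: The formal theorem assumes ℓ ≥ 2; for ℓ = 1 the statement is false for every k, since f_{k,1}(n) = ⌈n/k⌉ + k − 1 is unbounded while M·1^{n/k} = M is constant. -}

module Defs where

import Algebra.Definitions.RawSemiring as RawSemiring
open import Data.Empty using (⊥)
open import Data.Fin.Base using (Fin)
import Data.Fin.Properties as Fin
open import Data.Integer.Base using (+_)
open import Data.List.Base using (applyUpTo)
open import Data.Nat.Base as ℕ using (ℕ; zero; suc; NonZero)
open import Data.Nat.DivMod using (_/_)
open import Data.Nat.ListAction using (sum)
import Data.Nat.Properties as ℕ
open import Data.Product.Base using (∃; ∃₂; _×_; _,_; proj₁; proj₂)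
open import Data.Rational.Base as ℚ using (ℚ; 0ℚ; 1ℚ)
import Data.Rational.Properties as ℚ
open import Data.Sum.Base using (inj₁; inj₂)
open import Level using (Level; Lift; 0ℓ)
open import Relation.Binary.Bundles using (DecPoset)
open import Relation.Binary.Definitions
  using (Reflexive; Transitive; Antisymmetric; Decidable)
open import Relation.Binary.PropositionalEquality
  using (_≡_; refl; sym; cong; subst; isEquivalence)
open import Relation.Nullary.Decidable using (yes; no; map′; _×-dec_)
open import Relation.Nullary.Negation using (¬_)
open import Relation.Unary using (Pred; _≐_)

open RawSemiring ℚ.+-*-rawSemiring using () renaming (_^_ to _^ℚ_)

------------------------------------------------------------------------
-- Real numbers

-- A real number is a Dedekind cut, given by its lower half: a nonempty
-- proper subset of ℚ that is downward closed and has no greatest element.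
record ℝ : Set₁ where
  infix 4 _∋_
  field
    _∋_       : ℚ → Set
    inhabited : ∃ λ p → _∋_ p
    proper    : ∃ λ p → ¬ _∋_ p
    downward  : ∀ {p q} → p ℚ.< q → _∋_ q → _∋_ p
    open-end  : ∀ {p} → _∋_ p → ∃ λ q → p ℚ.< q × _∋_ q

open ℝ using (_∋_)

infix 4 _≤ᴿ_

_≤ᴿ_ : ℝ → ℝ → Set
x ≤ᴿ y = ∀ {p} → x ∋ p → y ∋ p

record ℝ⁺ : Set₁ where
  constructor mkℝ⁺
  field
    value    : ℝ
    positive : value ∋ 0ℚ

open ℝ⁺ public using (value)

fromℚ : ℚ → ℝ
fromℚ r = record
  { _∋_       = ℚ._< r
  ; inhabited = r ℚ.- 1ℚ , subst (r ℚ.- 1ℚ ℚ.<_) (ℚ.+-identityʳ r)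
                             (ℚ.+-monoʳ-< r (ℚ.negative⁻¹ (ℚ.- 1ℚ)))
  ; proper    = r , ℚ.<-irrefl refl
  ; downward  = ℚ.<-trans
  ; open-end  = λ p<r → ℚ.<-dense p<r
  }

fromℕ : ℕ → ℝ
fromℕ n = fromℚ ((+ n) ℚ./ 1)

fromℕ⁺ : (n : ℕ) .{{_ : NonZero n}} → ℝ⁺
fromℕ⁺ n = mkℝ⁺ (fromℕ n) (ℚ.positive⁻¹ _ {{ℚ.normalize-pos n 1}})

private
  module _ (x : ℝ) where
    open ℝ x using (downward)

    downward-≤ : ∀ {p q} → p ℚ.≤ q → x ∋ q → x ∋ p
    downward-≤ {p} {q} p≤q q∈x with p ℚ.<? q
    ... | yes p<q = downward p<q q∈x
    ... | no  p≮q = subst (x ∋_) (ℚ.≤-antisym (ℚ.≮⇒≥ p≮q) p≤q) q∈x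

    below : ∀ {b p} → ¬ x ∋ b → x ∋ p → p ℚ.< b
    below b∉x p∈x = ℚ.≰⇒> λ b≤p → b∉x (downward-≤ b≤p p∈x)

  *-pos : ∀ {a b} → 0ℚ ℚ.< a → 0ℚ ℚ.< b → 0ℚ ℚ.< a ℚ.* b
  *-pos {a} {b} 0<a 0<b =
    subst (ℚ._< a ℚ.* b) (ℚ.*-zeroʳ a) (ℚ.*-monoʳ-<-pos a {{ℚ.positive 0<a}} 0<b)

  ^-≥1 : ∀ {t} → 1ℚ ℚ.≤ t → ∀ j → 1ℚ ℚ.≤ t ^ℚ j
  ^-≥1 1≤t zero = ℚ.≤-refl
  ^-≥1 {t} 1≤t (suc j) = ℚ.≤-trans 1≤t
    (subst (ℚ._≤ t ^ℚ suc j) (ℚ.*-identityʳ t)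
      (ℚ.*-monoˡ-≤-nonNeg t {{ℚ.nonNegative (ℚ.≤-trans (ℚ.nonNegative⁻¹ 1ℚ) 1≤t)}}
        (^-≥1 1≤t j)))

  ^-≤1 : ∀ {t} → 0ℚ ℚ.< t → t ℚ.≤ 1ℚ → ∀ j → t ^ℚ j ℚ.≤ 1ℚ
  ^-≤1 0<t t≤1 zero = ℚ.≤-refl
  ^-≤1 {t} 0<t t≤1 (suc j) = ℚ.≤-trans
    (subst (t ^ℚ suc j ℚ.≤_) (ℚ.*-identityʳ t)
      (ℚ.*-monoˡ-≤-nonNeg t {{ℚ.nonNegative (ℚ.<⇒≤ 0<t)}} (^-≤1 0<t t≤1 j)))
    t≤1

infixl 7 _*⁺_

_*⁺_ : ℝ⁺ → ℝ⁺ → ℝ⁺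
mkℝ⁺ x 0<x *⁺ mkℝ⁺ y 0<y = mkℝ⁺ (record
  { _∋_       = In
  ; inhabited = 0ℚ , 0∈
  ; proper    = proj₁ x.proper ℚ.* proj₁ y.proper , out
  ; downward  = λ { p<q (a , b , 0<a , 0<b , a∈x , b∈y , q<ab) →
                    a , b , 0<a , 0<b , a∈x , b∈y , ℚ.<-trans p<q q<ab }
  ; open-end  = λ { (a , b , 0<a , 0<b , a∈x , b∈y , p<ab) →
                    let (q , p<q , q<ab) = ℚ.<-dense p<ab
                    in q , p<q , a , b , 0<a , 0<b , a∈x , b∈y , q<ab }
  }) 0∈
  where
  module x = ℝ x
  module y = ℝ y

  In : ℚ → Set
  In p = ∃₂ λ a b → 0ℚ ℚ.< a × 0ℚ ℚ.< b × x ∋ a × y ∋ b × p ℚ.< a ℚ.* b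

  0∈ : In 0ℚ
  0∈ = let (a , 0<a , a∈x) = x.open-end 0<x
           (b , 0<b , b∈y) = y.open-end 0<y
       in a , b , 0<a , 0<b , a∈x , b∈y , *-pos 0<a 0<b

  out : ¬ In (proj₁ x.proper ℚ.* proj₁ y.proper)
  out (a , b , 0<a , 0<b , a∈x , b∈y , AB<ab) = ℚ.<-asym AB<ab (ℚ.<-trans
    (ℚ.*-monoˡ-<-pos b {{ℚ.positive 0<b}} a<A)
    (ℚ.*-monoʳ-<-pos A {{ℚ.positive (ℚ.<-trans 0<a a<A)}} b<B))
    where
    A = proj₁ x.proper
    a<A = below x (proj₂ x.proper) a∈x
    b<B = below y (proj₂ y.proper) b∈y

-- x ^{1/k} as the supremum of the rationals t > 0 with t ^ k < x.
nthRoot : (k : ℕ) .{{_ : NonZero k}} → ℝ⁺ → ℝ⁺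
nthRoot (suc j) (mkℝ⁺ x 0<x) = mkℝ⁺ (record
  { _∋_       = In
  ; inhabited = 0ℚ , 0∈
  ; proper    = B ℚ.⊔ 1ℚ , out
  ; downward  = λ { p<q (t , 0<t , tᵏ∈x , q<t) →
                    t , 0<t , tᵏ∈x , ℚ.<-trans p<q q<t }
  ; open-end  = λ { (t , 0<t , tᵏ∈x , p<t) →
                    let (q , p<q , q<t) = ℚ.<-dense p<t
                    in q , p<q , t , 0<t , tᵏ∈x , q<t }
  }) 0∈
  where
  module x = ℝ x
  B = proj₁ x.proper

  In : ℚ → Set
  In p = ∃ λ t → 0ℚ ℚ.< t × x ∋ t ^ℚ suc j × p ℚ.< t

  0∈ : In 0ℚ
  0∈ = t , 0<t , downward-≤ x tᵏ≤a a∈x , 0<t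
    where
    a   = proj₁ (x.open-end 0<x)
    0<a = proj₁ (proj₂ (x.open-end 0<x))
    a∈x = proj₂ (proj₂ (x.open-end 0<x))
    t   = a ℚ.⊓ 1ℚ

    0<t : 0ℚ ℚ.< t
    0<t with ℚ.⊓-sel a 1ℚ
    ... | inj₁ e = subst (0ℚ ℚ.<_) (sym e) 0<a
    ... | inj₂ e = subst (0ℚ ℚ.<_) (sym e) (ℚ.positive⁻¹ 1ℚ)

    tᵏ≤a : t ^ℚ suc j ℚ.≤ a
    tᵏ≤a = ℚ.≤-trans
      (subst (t ^ℚ suc j ℚ.≤_) (ℚ.*-identityʳ t)
        (ℚ.*-monoˡ-≤-nonNeg t {{ℚ.nonNegative (ℚ.<⇒≤ 0<t)}}
          (^-≤1 0<t (ℚ.p⊓q≤q a 1ℚ) j)))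
      (ℚ.p⊓q≤p a 1ℚ)

  out : ¬ In (B ℚ.⊔ 1ℚ)
  out (t , 0<t , tᵏ∈x , B⊔1<t) = ℚ.<-asym (below x (proj₂ x.proper) tᵏ∈x)
    (ℚ.<-≤-trans (ℚ.≤-<-trans (ℚ.p≤p⊔q B 1ℚ) B⊔1<t)
      (subst (ℚ._≤ t ^ℚ suc j) (ℚ.*-identityʳ t)
        (ℚ.*-monoˡ-≤-nonNeg t {{ℚ.nonNegative (ℚ.<⇒≤ 0<t)}}
          (^-≥1 (ℚ.≤-trans (ℚ.p≤q⊔p B 1ℚ) (ℚ.<⇒≤ B⊔1<t)) j))))

infixr 8 _^[_/_]

_^[_/_] : (a n k : ℕ) .{{_ : NonZero a}} .{{_ : NonZero k}} → ℝ⁺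
a ^[ n / k ] = nthRoot k (fromℕ⁺ (a ℕ.^ n) {{ℕ.m^n≢0 a n}})

infix 4 _=Θ_

_=Θ_ : (ℕ → ℕ) → (ℕ → ℝ⁺) → Set₁
g =Θ h = ∃₂ λ (c C : ℝ⁺) → ∃ λ n₀ → ∀ n → n₀ ℕ.≤ n →
  value (c *⁺ h n) ≤ᴿ fromℕ (g n) × fromℕ (g n) ≤ᴿ value (C *⁺ h n)

------------------------------------------------------------------------
-- The hidden ideal problem

module HiddenIdeal {c ℓ₁ ℓ₂ : Level} (Λ : DecPoset c ℓ₁ ℓ₂) where
  open DecPoset Λ

  data Ideal : Set c where
    ∅  : Ideal
    ↓_ : Carrier → Ideal

  infix 4 _∈_ _∈?_

  _∈_ : Carrier → Ideal → Set ℓ₂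
  u ∈ ∅     = Lift ℓ₂ ⊥
  u ∈ (↓ v) = u ≤ v

  _∈?_ : Decidable _∈_
  u ∈? ∅     = no λ ()
  u ∈? (↓ v) = u ≤? v

  ⟦_⟧ : Ideal → Pred Carrier ℓ₂
  ⟦ μ ⟧ v = v ∈ μ

  -- An adaptive strategy is a decision tree: either announce an ideal, or
  -- query v and continue according to the answer.
  data Strategy : Set c where
    announce : Ideal → Strategy
    query    : (v : Carrier) (pos neg : Strategy) → Strategy

  output : Strategy → Ideal → Ideal
  output (announce ν)      μ = ν
  output (query v pos neg) μ with v ∈? μ
  ... | yes _ = output pos μ
  ... | no  _ = output neg μ

  #queries : Strategy → Ideal → ℕ
  #queries (announce ν)      μ = 0
  #queries (query v pos neg) μ with v ∈? μ
  ... | yes _ = suc (#queries pos μ)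
  ... | no  _ = suc (#queries neg μ)

  #positives : Strategy → Ideal → ℕ
  #positives (announce ν)      μ = 0
  #positives (query v pos neg) μ with v ∈? μ
  ... | yes _ = suc (#positives pos μ)
  ... | no  _ = #positives neg μ

  Solves : (k N : ℕ) → Strategy → Set _
  Solves k N s = ∀ μ →
    ⟦ output s μ ⟧ ≐ ⟦ μ ⟧ × #queries s μ ℕ.≤ N × #positives s μ ℕ.≤ k

  Solvable : (k N : ℕ) → Set _
  Solvable k N = ∃ (Solves k N)

-- N = 𝒒 k Λ, the least number of queries that suffices.
Is𝒒 : ∀ {c ℓ₁ ℓ₂} → ℕ → DecPoset c ℓ₁ ℓ₂ → ℕ → Set _
Is𝒒 k Λ N = Solvable k N × (∀ N′ → Solvable k N′ → N ℕ.≤ N′)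
  where open HiddenIdeal Λ

------------------------------------------------------------------------
-- Complete trees

-- The tree of height suc n is a root together with ℓ copies of the tree
-- of height n above it.
data Node (ℓ : ℕ) : ℕ → Set where
  root  : ∀ {n} → Node ℓ (suc n)
  child : ∀ {n} → Fin ℓ → Node ℓ n → Node ℓ (suc n)

infix 4 _≼_

data _≼_ {ℓ : ℕ} : ∀ {n} → Node ℓ n → Node ℓ n → Set where
  root≼  : ∀ {n} {v : Node ℓ (suc n)} → root ≼ v
  child≼ : ∀ {n i} {u v : Node ℓ n} → u ≼ v → child i u ≼ child i v

module _ {ℓ : ℕ} where

  ≼-refl : ∀ {n} → Reflexive (_≼_ {ℓ} {n})
  ≼-refl {x = root}      = root≼
  ≼-refl {x = child i u} = child≼ ≼-refl

  ≼-reflexive : ∀ {n} {u v : Node ℓ n} → u ≡ v → u ≼ v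
  ≼-reflexive refl = ≼-refl

  ≼-trans : ∀ {n} → Transitive (_≼_ {ℓ} {n})
  ≼-trans root≼      _          = root≼
  ≼-trans (child≼ p) (child≼ q) = child≼ (≼-trans p q)

  ≼-antisym : ∀ {n} → Antisymmetric _≡_ (_≼_ {ℓ} {n})
  ≼-antisym root≼      root≼      = refl
  ≼-antisym (child≼ p) (child≼ q) = cong (child _) (≼-antisym p q)

  _≼?_ : ∀ {n} → Decidable (_≼_ {ℓ} {n})
  root      ≼? v         = yes root≼
  child i u ≼? root      = no λ ()
  child i u ≼? child j v with i Fin.≟ j
  ... | no  i≢j  = no λ { (child≼ _) → i≢j refl }
  ... | yes refl = map′ child≼ (λ { (child≼ p) → p }) (u ≼? v)

  _≟ᴺ_ : ∀ {n} → Decidable (_≡_ {A = Node ℓ n})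
  u ≟ᴺ v = map′ (λ (p , q) → ≼-antisym p q)
                (λ e → ≼-reflexive e , ≼-reflexive (sym e))
                ((u ≼? v) ×-dec (v ≼? u))

𝒯 : (ℓ n : ℕ) → DecPoset 0ℓ 0ℓ 0ℓ
𝒯 ℓ n = record
  { Carrier           = Node ℓ n
  ; _≈_               = _≡_
  ; _≤_               = _≼_
  ; isDecPartialOrder = record
    { isPartialOrder = record
      { isPreorder = record
        { isEquivalence = isEquivalence
        ; reflexive     = ≼-reflexive
        ; trans         = ≼-trans
        }
      ; antisym = ≼-antisym
      }
    ; _≟_  = _≟ᴺ_
    ; _≤?_ = _≼?_
    }
  }

------------------------------------------------------------------------
-- The upper bound

⌈_/_⌉ : (n k : ℕ) .{{_ : NonZero k}} → ℕ
⌈ n / k ⌉ = (n ℕ.+ (k ℕ.∸ 1)) / k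

-- In the second sum j = suc i < k, so -1 < (n - j) / k and the exponent
-- ⌈ (n - j) / k ⌉ is 0 when n ≤ j: truncated subtraction gives the same value.
f : (k ℓ : ℕ) .{{_ : NonZero k}} → ℕ → ℕ
f k ℓ n = sum (applyUpTo (λ i → ℓ ℕ.^ i) ⌈ n / k ⌉)
    ℕ.+ sum (applyUpTo (λ i → ℓ ℕ.^ ⌈ n ℕ.∸ suc i / k ⌉) (k ℕ.∸ 1))

{-# OPTIONS --safe #-}

-- Upper bound: cut the tree into k horizontal blocks of heights ⌈(n-j)/k⌉,
-- j = k-1, …, 0, whose sum is n by Hermite's identity.  Query all nodes of the
-- first level of the second block; after a positive answer continue in the
-- subtree found, with one positive answer fewer, and otherwise run through the
-- first block from its top level downwards, which needs one positive answer.
--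
-- Lower bound: a decision tree with at most N queries and at most k positive
-- answers on each branch has at most (1 + N)^k leaves, and there are more than
-- ℓ^(n-1) ideals, whence ℓ^n ≤ (2ℓN)^k.
--
-- That the minimum 𝒒 is attained needs decidability of solvability, which
-- follows by recursion on the number of queries, over the sets of ideals that
-- are consistent with the answers so far.

module Submission where

open import Defs
open import Data.Nat.Base using (ℕ; NonZero; _≤_)
open import Data.Product.Base using (∃; ∃₂; _×_)

import Algebra.Definitions.RawSemiring as RawSemiring
open import Data.Fin.Base as Fin using (Fin)
import Data.Fin.Properties as Fin
open import Data.Integer.Base as ℤ using () renaming (+_ to pos)
import Data.Integer.Properties as ℤ
open import Data.List.Base
  using (List; []; _∷_; _++_; _∷ʳ_; map; length; lookup; allFin; applyUpTo; cartesianProductWith)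
open import Data.List.Membership.Propositional using (lose) renaming (_∈_ to _∈ˡ_)
open import Data.List.Membership.Propositional.Properties
  using (∈-map⁺; ∈-++⁺ˡ; ∈-++⁺ʳ; ∈-allFin; ∈-cartesianProductWith⁺; ∈-cartesianProductWith⁻)
open import Data.List.Properties
  using (length-map; length-++; length-tabulate; length-applyUpTo; map-applyUpTo; applyUpTo-∷ʳ)
open import Data.List.Relation.Unary.All as All using (All; []; _∷_)
import Data.List.Relation.Unary.All.Properties as All
open import Data.List.Relation.Unary.Any using (here; there; any?; satisfied; index)
open import Data.List.Relation.Unary.Any.Properties using (lookup-index)
open import Data.Nat.Base
  using (zero; suc; _+_; _*_; _^_; _∸_; _<_; z≤n; s≤s; _≤′_; ≤′-refl; ≤′-step)
open import Data.Nat.Divisibility using (∣-refl)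
open import Data.Nat.DivMod
  using (_/_; /-monoˡ-≤; +-distrib-/-∣ʳ; n/n≡1; m<n⇒m/n≡0; m/n*n≤m)
open import Data.Nat.ListAction using (sum)
open import Data.Nat.ListAction.Properties using (sum-++)
import Data.Nat.Properties as ℕ
open import Data.Product.Base using (_,_; proj₁; proj₂)
open import Data.Rational.Base as ℚ using (ℚ; 0ℚ; 1ℚ; fromℚᵘ; toℚᵘ)
import Data.Rational.Properties as ℚ
open import Data.Rational.Unnormalised.Base as ℚᵘ using (mkℚᵘ; *≡*; *≤*; *<*)
import Data.Rational.Unnormalised.Properties as ℚᵘ
open import Data.Sum.Base using (inj₁; inj₂)
open import Data.Unit.Polymorphic.Base using (⊤; tt)
open import Function.Base using (_∘_)
open import Level using (Level; _⊔_)
open import Relation.Binary.Bundles using (DecPoset)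
open import Relation.Binary.PropositionalEquality
  using (_≡_; refl; sym; trans; cong; cong₂; subst; subst₂; module ≡-Reasoning)
open import Relation.Nullary.Decidable using (Dec; yes; no; map′; _×-dec_; _→-dec_; ¬?)
open import Relation.Nullary.Negation using (¬_; contradiction)
open import Relation.Unary using (Pred; _≐_; Decidable)

open RawSemiring ℚ.+-*-rawSemiring using () renaming (_^_ to _^ℚ_)

-- The hidden ideal problem in a decidable poset

module BoundedSearch {c ℓ₁ ℓ₂ : Level} (Λ : DecPoset c ℓ₁ ℓ₂) where
  open DecPoset Λ using (Carrier)
  open HiddenIdeal Λ

  -- `Solves` for a single ideal, as an inductive relation: `N` and `K` are allowances spent along
  -- the path of `μ`, so that proofs go by induction on this path.
  data Run (μ : Ideal) : ℕ → ℕ → Strategy → Set (c ⊔ ℓ₂) where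
    announced : ∀ {N K ν} → ⟦ ν ⟧ ≐ ⟦ μ ⟧ → Run μ N K (announce ν)
    positive  : ∀ {N K v s t} → v ∈ μ → Run μ N K s → Run μ (suc N) (suc K) (query v s t)
    negative  : ∀ {N K v s t} → ¬ v ∈ μ → Run μ N K t → Run μ (suc N) K (query v s t)

  Run-mono : ∀ {μ N N′ K K′ s} → N ≤ N′ → K ≤ K′ → Run μ N K s → Run μ N′ K′ s
  Run-mono _       _       (announced e)    = announced e
  Run-mono (s≤s p) (s≤s q) (positive v∈μ r) = positive v∈μ (Run-mono p q r)
  Run-mono (s≤s p) q       (negative v∉μ r) = negative v∉μ (Run-mono p q r)

  announced⁻ : ∀ {μ N K ν} → Run μ N K (announce ν) → ⟦ ν ⟧ ≐ ⟦ μ ⟧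
  announced⁻ (announced e) = e

  Run⇒bounds : ∀ {μ N K s} → Run μ N K s →
    ⟦ output s μ ⟧ ≐ ⟦ μ ⟧ × #queries s μ ≤ N × #positives s μ ≤ K
  Run⇒bounds (announced e) = e , z≤n , z≤n
  Run⇒bounds {μ} (positive {v = v} v∈μ r) with v ∈? μ
  ... | yes _   = let (e , p , q) = Run⇒bounds r in e , s≤s p , s≤s q
  ... | no  v∉μ = contradiction v∈μ v∉μ
  Run⇒bounds {μ} (negative {v = v} v∉μ r) with v ∈? μ
  ... | yes v∈μ = contradiction v∈μ v∉μ
  ... | no  _   = let (e , p , q) = Run⇒bounds r in e , s≤s p , q

  bounds⇒Run : ∀ {μ N K} s →
    ⟦ output s μ ⟧ ≐ ⟦ μ ⟧ × #queries s μ ≤ N × #positives s μ ≤ K → Run μ N K s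
  bounds⇒Run (announce ν) (e , _) = announced e
  bounds⇒Run {μ} (query v s t) b with v ∈? μ
  bounds⇒Run {μ} (query v s t) (e , s≤s p , s≤s q) | yes v∈μ =
    positive v∈μ (bounds⇒Run s (e , p , q))
  bounds⇒Run {μ} (query v s t) (e , s≤s p , q) | no v∉μ =
    negative v∉μ (bounds⇒Run t (e , p , q))

  -- Counting the outcomes of a strategy

  outputs : ℕ → ℕ → Strategy → List Ideal
  outputs N       K       (announce ν)  = ν ∷ []
  outputs zero    K       (query v s t) = []
  outputs (suc N) zero    (query v s t) = outputs N zero t
  outputs (suc N) (suc K) (query v s t) = outputs N K s ++ outputs N (suc K) t

  ∈-outputs : ∀ {μ N K s} → Run μ N K s → ∃ λ ν → ν ∈ˡ outputs N K s × ⟦ ν ⟧ ≐ ⟦ μ ⟧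
  ∈-outputs {N = zero}  (announced e) = _ , here refl , e
  ∈-outputs {N = suc N} (announced e) = _ , here refl , e
  ∈-outputs (positive _ r) = let (ν , ν∈ , e) = ∈-outputs r in ν , ∈-++⁺ˡ ν∈ , e
  ∈-outputs {K = zero}  (negative _ r) = ∈-outputs r
  ∈-outputs {N = suc N} {K = suc K} (negative {s = s} _ r) =
    let (ν , ν∈ , e) = ∈-outputs r in ν , ∈-++⁺ʳ (outputs N K s) ν∈ , e

  -- Branches beyond the allowance are cut off, so the count obeys a Pascal-like recursion in `N`
  -- and `K`. Its two terms sum to `(1 + N) ^ K + (1 + N) ^ (1 + K)`, that is
  -- `(2 + N) * (1 + N) ^ K`.
  length-outputs : ∀ N K s → length (outputs N K s) ≤ suc N ^ K
  length-outputs zero    K       (announce ν)  = ℕ.m^n>0 1 K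
  length-outputs (suc N) K       (announce ν)  = ℕ.m^n>0 (suc (suc N)) K
  length-outputs zero    K       (query v s t) = z≤n
  length-outputs (suc N) zero    (query v s t) = length-outputs N zero t
  length-outputs (suc N) (suc K) (query v s t) = begin
    length (outputs N K s ++ outputs N (suc K) t)
      ≡⟨ length-++ (outputs N K s) ⟩
    length (outputs N K s) + length (outputs N (suc K) t)
      ≤⟨ ℕ.+-mono-≤ (length-outputs N K s) (length-outputs N (suc K) t) ⟩
    suc (suc N) * suc N ^ K
      ≤⟨ ℕ.*-monoʳ-≤ (suc (suc N)) (ℕ.^-monoˡ-≤ K (ℕ.n≤1+n (suc N))) ⟩
    suc (suc N) ^ suc K ∎
    where open ℕ.≤-Reasoning

  -- Distinct ideals have distinct outputs, so pigeonhole applies.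
  ideals≤[1+N]^K : ∀ {a N K} → Solvable K N → (g : Fin a → Ideal) →
    (∀ {i j} → ⟦ g i ⟧ ≐ ⟦ g j ⟧ → i ≡ j) → a ≤ suc N ^ K
  ideals≤[1+N]^K {a} {N} {K} (s , solves) g g-inj =
    ℕ.≤-trans (Fin.injective⇒≤ code-inj) (length-outputs N K s)
    where
    found : ∀ i → ∃ λ ν → ν ∈ˡ outputs N K s × ⟦ ν ⟧ ≐ ⟦ g i ⟧
    found i = ∈-outputs (bounds⇒Run s (solves (g i)))

    code : Fin a → Fin (length (outputs N K s))
    code i = index (proj₁ (proj₂ (found i)))

    code-inj : ∀ {i j} → code i ≡ code j → i ≡ j
    code-inj {i} {j} eq with found i | found j
    ... | ν , ν∈ , p , p′ | ν′ , ν′∈ , q , q′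
      with refl ← trans (lookup-index ν∈) (trans (cong (lookup (outputs N K s)) eq) (sym (lookup-index ν′∈)))
      = g-inj ((λ x → q (p′ x)) , (λ x → p (q′ x)))

  -- Querying a list of elements in turn

  scan : List (Carrier × Strategy) → Strategy → Strategy
  scan []             t = t
  scan ((v , s) ∷ xs) t = query v s (scan xs t)

  -- A hit spends a positive answer, so its continuation has only `K` left; a run of misses spends
  -- queries alone, so `t` keeps all `suc K`.
  scan-Run : ∀ {μ N K} xs {t} →
    (∀ {v s} → (v , s) ∈ˡ xs → v ∈ μ → Run μ N K s) →
    ((∀ {v s} → (v , s) ∈ˡ xs → ¬ v ∈ μ) → Run μ N (suc K) t) →
    Run μ (length xs + N) (suc K) (scan xs t)
  scan-Run []             hit miss = miss λ ()
  scan-Run {μ} {N} ((v , s) ∷ xs) hit miss with v ∈? μ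
  ... | yes v∈μ = positive v∈μ (Run-mono (ℕ.m≤n+m N (length xs)) ℕ.≤-refl (hit (here refl) v∈μ))
  ... | no  v∉μ = negative v∉μ (scan-Run xs (hit ∘ there) λ none →
    miss λ { (here refl) → v∉μ ; (there x∈) → none x∈ })

  -- Decidability of solvability

  module _ (elements : List Carrier) (complete : ∀ v → v ∈ˡ elements) where

    private
      ideals : List Ideal
      ideals = ∅ ∷ map ↓_ elements

      ∈-ideals : ∀ μ → μ ∈ˡ ideals
      ∈-ideals ∅     = here refl
      ∈-ideals (↓ v) = there (∈-map⁺ ↓_ (complete v))

      module _ {a p} {A : Set a} (xs : List A) (every : ∀ x → x ∈ˡ xs)
               {P : Pred A p} (P? : Decidable P) where

        all : Dec (∀ x → P x)
        all = map′ (λ ps x → All.lookup ps (every x)) (λ ps → All.universal ps xs)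
                   (All.all? P? xs)

        any : Dec (∃ P)
        any = map′ satisfied (λ (x , px) → lose (every x) px) (any? P? xs)

      _≐?_ : ∀ ν μ → Dec (⟦ ν ⟧ ≐ ⟦ μ ⟧)
      ν ≐? μ = map′ (λ h → (λ {x} → proj₁ (h x)) , (λ {x} → proj₂ (h x)))
                    (λ (p , q) x → p , q)
                    (all elements complete λ x →
                      (x ∈? ν →-dec x ∈? μ) ×-dec (x ∈? μ →-dec x ∈? ν))

    Resolvable : ℕ → ℕ → Pred Ideal (c ⊔ ℓ₂) → Set (c ⊔ ℓ₂)
    Resolvable N K C = ∃ λ s → ∀ μ → C μ → Run μ N K s

    resolvable? : ∀ N K {C} → Decidable C → Dec (Resolvable N K C)
    resolvable? N K {C} C? with
      any ideals ∈-ideals (λ ν → all ideals ∈-ideals (λ μ → C? μ →-dec (ν ≐? μ)))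
    ... | yes (ν , e) = yes (announce ν , λ μ μ∈C → announced (e μ μ∈C))
    resolvable? zero K {C} C? | no ¬e = no λ
      { (announce ν , r) → ¬e (ν , λ μ μ∈C → announced⁻ (r μ μ∈C))
      -- With no queries left a strategy that asks one has no run, so `C` is empty and any
      -- announcement would do.
      ; (query v s t , r) → ¬e (∅ , λ μ μ∈C → contradiction (r μ μ∈C) λ ())
      }
    resolvable? (suc N) K {C} C? | no ¬e = map′ to from
      (any elements complete λ v → pos? v K ×-dec
        resolvable? N K (λ μ → C? μ ×-dec ¬? (v ∈? μ)))
      where
      -- Once the positive answers are used up, `v` may be queried only if no consistent ideal
      -- contains it.
      Pos : Carrier → ℕ → Set (c ⊔ ℓ₂)
      Pos v zero    = ∀ μ → C μ → ¬ v ∈ μ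
      Pos v (suc K) = Resolvable N K (λ μ → C μ × v ∈ μ)

      pos? : ∀ v K → Dec (Pos v K)
      pos? v zero    = all ideals ∈-ideals (λ μ → C? μ →-dec ¬? (v ∈? μ))
      pos? v (suc K) = resolvable? N K (λ μ → C? μ ×-dec (v ∈? μ))

      Neg : Carrier → ℕ → Set (c ⊔ ℓ₂)
      Neg v K = Resolvable N K (λ μ → C μ × ¬ v ∈ μ)

      to : ∀ {K} → (∃ λ v → Pos v K × Neg v K) → Resolvable (suc N) K C
      -- The positive branch is never taken; `t` merely fills it.
      to {zero} (v , never , t , r) = query v t t , λ μ μ∈C →
        negative (never μ μ∈C) (r μ (μ∈C , never μ μ∈C))
      to {suc K} (v , (s , r) , t , r′) = query v s t , run
        where
        run : ∀ μ → C μ → Run μ (suc N) (suc K) (query v s t)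
        run μ μ∈C with v ∈? μ
        ... | yes v∈μ = positive v∈μ (r μ (μ∈C , v∈μ))
        ... | no  v∉μ = negative v∉μ (r′ μ (μ∈C , v∉μ))

      onPos : ∀ {K v s t} → (∀ μ → C μ → Run μ (suc N) K (query v s t)) → Pos v K
      onPos {zero} r μ μ∈C with r μ μ∈C
      ... | negative v∉μ _ = v∉μ
      onPos {suc K} {v} {s} {t} r = s , run
        where
        run : ∀ μ → C μ × v ∈ μ → Run μ N K s
        run μ (μ∈C , v∈μ) with r μ μ∈C
        ... | positive _   r′ = r′
        ... | negative v∉μ _  = contradiction v∈μ v∉μ

      onNeg : ∀ {K v s t} → (∀ μ → C μ → Run μ (suc N) K (query v s t)) → Neg v K
      onNeg {K} {v} {s} {t} r = t , run
        where
        run : ∀ μ → C μ × ¬ v ∈ μ → Run μ N K t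
        run μ (μ∈C , v∉μ) with r μ μ∈C
        ... | positive v∈μ _  = contradiction v∈μ v∉μ
        ... | negative _   r′ = r′

      from : Resolvable (suc N) K C → ∃ λ v → Pos v K × Neg v K
      from (announce ν , r) = contradiction (ν , λ μ μ∈C → announced⁻ (r μ μ∈C)) ¬e
      from (query v s t , r) = v , onPos r , onNeg r

    solvable? : ∀ K N → Dec (Solvable K N)
    solvable? K N = map′
      (λ (s , r) → s , λ μ → Run⇒bounds (r μ tt))
      (λ (s , b) → s , λ μ _ → bounds⇒Run s (b μ))
      (resolvable? N K {λ _ → ⊤} λ _ → yes tt)

-- Arithmetic

least : ∀ {p} {P : Pred ℕ p} → Decidable P → ∀ n → P n →
  ∃ λ m → P m × (∀ m′ → P m′ → m ≤ m′)
least P? zero    p = zero , p , λ _ _ → z≤n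
least P? (suc n) p with P? zero
... | yes p₀ = zero , p₀ , λ _ _ → z≤n
... | no ¬p₀ with m , pₘ , min ← least (P? ∘ suc) n p = suc m , pₘ , λ where
  zero     p₀ → contradiction p₀ ¬p₀
  (suc m′) p′ → s≤s (min m′ p′)

length-cartesianProductWith : ∀ {a b c} {A : Set a} {B : Set b} {C : Set c}
  (g : A → B → C) xs ys → length (cartesianProductWith g xs ys) ≡ length xs * length ys
length-cartesianProductWith g []       ys = refl
length-cartesianProductWith g (x ∷ xs) ys = trans (length-++ (map (g x) ys))
  (cong₂ _+_ (length-map (g x) ys) (length-cartesianProductWith g xs ys))

sum-applyUpTo-suc : ∀ g n → sum (applyUpTo g (suc n)) ≡ g n + sum (applyUpTo g n)
sum-applyUpTo-suc g n = begin
  sum (applyUpTo g (suc n))         ≡⟨ cong sum (applyUpTo-∷ʳ g n) ⟨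
  sum (applyUpTo g n ∷ʳ g n)        ≡⟨ sum-++ (applyUpTo g n) (g n ∷ []) ⟩
  sum (applyUpTo g n) + (g n + 0)   ≡⟨ cong (sum (applyUpTo g n) +_) (ℕ.+-identityʳ (g n)) ⟩
  sum (applyUpTo g n) + g n         ≡⟨ ℕ.+-comm _ (g n) ⟩
  g n + sum (applyUpTo g n)         ∎
  where open ≡-Reasoning

sum-applyUpTo-≤ : ∀ g n {b} → (∀ i → g i ≤ b) → sum (applyUpTo g n) ≤ n * b
sum-applyUpTo-≤ g zero    g≤b = z≤n
sum-applyUpTo-≤ g (suc n) g≤b = ℕ.+-mono-≤ (g≤b 0) (sum-applyUpTo-≤ (g ∘ suc) n (g≤b ∘ suc))

geometric : ℕ → ℕ → ℕ
geometric ℓ n = sum (applyUpTo (ℓ ^_) n)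

geometric-suc : ∀ ℓ n → geometric ℓ (suc n) ≡ ℓ ^ n + geometric ℓ n
geometric-suc ℓ = sum-applyUpTo-suc (ℓ ^_)

geometric-mono : ∀ ℓ {m n} → m ≤ n → geometric ℓ m ≤ geometric ℓ n
geometric-mono ℓ m≤n = go (ℕ.≤⇒≤′ m≤n)
  where
  go : ∀ {m n} → m ≤′ n → geometric ℓ m ≤ geometric ℓ n
  go ≤′-refl = ℕ.≤-refl
  go {n = suc n} (≤′-step p) = ℕ.≤-trans (go p)
    (ℕ.≤-trans (ℕ.m≤n+m _ (ℓ ^ n)) (ℕ.≤-reflexive (sym (geometric-suc ℓ n))))

-- Each new power at least doubles the last and so absorbs the sum so far. For `ℓ = 1` the left side
-- is `n`, which outgrows the right.
geometric≤ : ∀ ℓ → 2 ≤ ℓ → ∀ n → geometric ℓ n ≤ ℓ ^ n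
geometric≤ ℓ 2≤ℓ zero    = z≤n
geometric≤ ℓ 2≤ℓ (suc n) = begin
  geometric ℓ (suc n)    ≡⟨ geometric-suc ℓ n ⟩
  ℓ ^ n + geometric ℓ n  ≤⟨ ℕ.+-monoʳ-≤ (ℓ ^ n) (geometric≤ ℓ 2≤ℓ n) ⟩
  ℓ ^ n + ℓ ^ n          ≡⟨ cong (ℓ ^ n +_) (ℕ.+-identityʳ (ℓ ^ n)) ⟨
  2 * ℓ ^ n              ≤⟨ ℕ.*-monoˡ-≤ (ℓ ^ n) 2≤ℓ ⟩
  ℓ ^ suc n              ∎
  where open ℕ.≤-Reasoning

-- Rounded quotients and the sum of the block heights

⌈/⌉-mono : ∀ k .{{_ : NonZero k}} {m n} → m ≤ n → ⌈ m / k ⌉ ≤ ⌈ n / k ⌉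
⌈/⌉-mono k m≤n = /-monoˡ-≤ k (ℕ.+-monoˡ-≤ (k ∸ 1) m≤n)

[n+k]/k : ∀ n k .{{_ : NonZero k}} → (n + k) / k ≡ suc (n / k)
[n+k]/k n k = begin
  (n + k) / k     ≡⟨ +-distrib-/-∣ʳ n ∣-refl ⟩
  n / k + k / k   ≡⟨ cong (n / k +_) (n/n≡1 k) ⟩
  n / k + 1       ≡⟨ ℕ.+-comm (n / k) 1 ⟩
  suc (n / k)     ∎
  where open ≡-Reasoning

⌈/⌉≤ : ∀ n k .{{_ : NonZero k}} → ⌈ n / k ⌉ ≤ suc (n / k)
⌈/⌉≤ n k = ℕ.≤-trans (/-monoˡ-≤ k (ℕ.+-monoʳ-≤ n (ℕ.m∸n≤m k 1))) (ℕ.≤-reflexive ([n+k]/k n k))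

-- Rewrites the last summand in `hermite`. For `n ≤ k` the truncated subtraction is harmless, as
-- both sides are 0.
⌈n∸k/1+k⌉ : ∀ n k → ⌈ n ∸ k / suc k ⌉ ≡ n / suc k
⌈n∸k/1+k⌉ n k with ℕ.≤-total k n
... | inj₁ k≤n = cong (_/ suc k) (ℕ.m∸n+n≡m k≤n)
... | inj₂ n≤k = begin
  (n ∸ k + k) / suc k  ≡⟨ cong (λ x → (x + k) / suc k) (ℕ.m≤n⇒m∸n≡0 n≤k) ⟩
  k / suc k            ≡⟨ m<n⇒m/n≡0 (ℕ.n<1+n k) ⟩
  0                    ≡⟨ m<n⇒m/n≡0 (s≤s n≤k) ⟨
  n / suc k            ∎
  where open ≡-Reasoning

-- A case of Hermite's identity, by induction on n: passing from n to n + 1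
-- shifts the summands and replaces the last one, n / (1 + k), by its successor.
hermite : ∀ n k → sum (applyUpTo (λ j → ⌈ n ∸ j / suc k ⌉) (suc k)) ≡ n
hermite zero    k = zeros (suc k)
  where
  zeros : ∀ i → sum (applyUpTo (λ j → ⌈ 0 ∸ j / suc k ⌉) i) ≡ 0
  zeros i = ℕ.n≤0⇒n≡0 (ℕ.≤-trans
    (sum-applyUpTo-≤ _ i λ j → ℕ.≤-trans (⌈/⌉-mono (suc k) (ℕ.m∸n≤m 0 j))
      (ℕ.≤-reflexive (m<n⇒m/n≡0 (ℕ.n<1+n k))))
    (ℕ.≤-reflexive (ℕ.*-zeroʳ i)))
hermite (suc n) k = begin
  ⌈ suc n / suc k ⌉ + s            ≡⟨ cong (λ x → x / suc k + s) (ℕ.+-suc n k) ⟨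
  (n + suc k) / suc k + s          ≡⟨ cong (_+ s) ([n+k]/k n (suc k)) ⟩
  suc (n / suc k + s)              ≡⟨ cong (λ x → suc (x + s)) (⌈n∸k/1+k⌉ n k) ⟨
  suc (⌈ n ∸ k / suc k ⌉ + s)      ≡⟨ cong suc (sum-applyUpTo-suc (λ j → ⌈ n ∸ j / suc k ⌉) k) ⟨
  suc (sum (applyUpTo (λ j → ⌈ n ∸ j / suc k ⌉) (suc k))) ≡⟨ cong suc (hermite n k) ⟩
  suc n                            ∎
  where
  open ≡-Reasoning
  s = sum (applyUpTo (λ j → ⌈ n ∸ j / suc k ⌉) k)

^-distribʳ-* : ∀ m n o → (m * n) ^ o ≡ m ^ o * n ^ o
^-distribʳ-* m n zero    = refl
^-distribʳ-* m n (suc o) = trans (cong (m * n *_) (^-distribʳ-* m n o))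
  (ℕ.[m*n]*[o*p]≡[m*o]*[n*p] m n (m ^ o) (n ^ o))

-- Complete trees

module Tree (ℓ : ℕ) where

  private
    open module H {n} = HiddenIdeal (𝒯 ℓ n)
      using (∅; ↓_; announce; query; _∈_; ⟦_⟧; Solvable)
    open module B′ {n} = BoundedSearch (𝒯 ℓ n)

    Ideal Strategy : ℕ → Set
    Ideal n    = HiddenIdeal.Ideal (𝒯 ℓ n)
    Strategy n = HiddenIdeal.Strategy (𝒯 ℓ n)

  -- Enumeration of the nodes and count of the ideals

  nodes : ∀ n → List (Node ℓ n)
  nodes zero    = []
  nodes (suc n) = root ∷ cartesianProductWith child (allFin ℓ) (nodes n)

  ∈-nodes : ∀ {n} (v : Node ℓ n) → v ∈ˡ nodes n
  ∈-nodes root        = here refl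
  ∈-nodes (child i v) = there (∈-cartesianProductWith⁺ child (∈-allFin i) (∈-nodes v))

  ↓-injective : ∀ {n} {u v : Node ℓ n} → ⟦ ↓ u ⟧ ≐ ⟦ ↓ v ⟧ → u ≡ v
  ↓-injective (p , q) = ≼-antisym (p ≼-refl) (q ≼-refl)

  -- The base-`ℓ` digits of the index, leading digit first, are the choices of child on the way from
  -- the root.
  leaf : ∀ n → Fin (ℓ ^ n) → Node ℓ (suc n)
  leaf zero    _ = root
  leaf (suc n) i = child (Fin.quotient (ℓ ^ n) i) (leaf n (Fin.remainder {ℓ} (ℓ ^ n) i))

  leaf-injective : ∀ n {i j} → leaf n i ≡ leaf n j → i ≡ j
  leaf-injective zero {Fin.zero} {Fin.zero} _ = refl
  leaf-injective (suc n) {i} {j} eq = begin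
    i          ≡⟨ Fin.combine-remQuot {ℓ} (ℓ ^ n) i ⟨
    Fin.combine (Fin.quotient {ℓ} (ℓ ^ n) i) (Fin.remainder {ℓ} (ℓ ^ n) i)
      ≡⟨ cong₂ Fin.combine (child-injectiveˡ eq) (leaf-injective n (child-injectiveʳ eq)) ⟩
    Fin.combine (Fin.quotient {ℓ} (ℓ ^ n) j) (Fin.remainder {ℓ} (ℓ ^ n) j)
      ≡⟨ Fin.combine-remQuot {ℓ} (ℓ ^ n) j ⟩
    j ∎
    where
    open ≡-Reasoning
    child-injectiveˡ : ∀ {n i j} {u v : Node ℓ n} → child i u ≡ child j v → i ≡ j
    child-injectiveˡ refl = refl
    child-injectiveʳ : ∀ {n i j} {u v : Node ℓ n} → child i u ≡ child j v → u ≡ v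
    child-injectiveʳ refl = refl

  -- Counts the ideals below the leaves, and `∅` as one more; this extra ideal is what later rules
  -- out `N = 0`.
  1+ℓ^n≤[1+N]^K : ∀ {n N K} → Solvable {suc n} K N → suc (ℓ ^ n) ≤ suc N ^ K
  1+ℓ^n≤[1+N]^K {n} solvable = ideals≤[1+N]^K solvable ideal injective
    where
    ideal : Fin (suc (ℓ ^ n)) → Ideal (suc n)
    ideal Fin.zero    = ∅
    ideal (Fin.suc i) = ↓ leaf n i

    injective : ∀ {i j} → ⟦ ideal i ⟧ ≐ ⟦ ideal j ⟧ → i ≡ j
    injective {Fin.zero}  {Fin.zero}  _       = refl
    injective {Fin.zero}  {Fin.suc j} (_ , q) = contradiction (q {root} root≼) λ ()
    injective {Fin.suc i} {Fin.zero}  (p , _) = contradiction (p {root} root≼) λ ()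
    injective {Fin.suc i} {Fin.suc j} e       = cong Fin.suc (leaf-injective n (↓-injective e))

  -- The block search behind the upper bound

  depth : ∀ {n} → Node ℓ n → ℕ
  depth root        = 0
  depth (child i v) = suc (depth v)

  depth<n : ∀ {n} (v : Node ℓ n) → depth v < n
  depth<n root        = s≤s z≤n
  depth<n (child i v) = s≤s (depth<n v)

  -- The number of elements of the ideal, which is a chain.
  height : ∀ {n} → Ideal n → ℕ
  height ∅     = 0
  height (↓ v) = suc (depth v)

  height≤n : ∀ {n} (μ : Ideal n) → height μ ≤ n
  height≤n ∅     = z≤n
  height≤n (↓ v) = depth<n v

  -- The value at `∅` is a placeholder: grafted strategies are analysed only on ideals that reach
  -- into child `i`, where a correct run never announces `∅`.
  graftᴵ : ∀ {n} → Fin ℓ → Ideal n → Ideal (suc n)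
  graftᴵ i ∅     = ↓ root
  graftᴵ i (↓ v) = ↓ child i v

  graftᴵ-cong : ∀ {n i} {ν : Ideal n} {v} → ⟦ ν ⟧ ≐ ⟦ ↓ v ⟧ → ⟦ graftᴵ i ν ⟧ ≐ ⟦ ↓ child i v ⟧
  graftᴵ-cong {ν = ∅}   (_ , q) = contradiction (q ≼-refl) λ ()
  graftᴵ-cong {ν = ↓ u} e with refl ← ↓-injective e = (λ p → p) , (λ p → p)

  graft : ∀ {n} → Fin ℓ → Strategy n → Strategy (suc n)
  graft i (announce ν)  = announce (graftᴵ i ν)
  graft i (query v s t) = query (child i v) (graft i s) (graft i t)

  graft-Run : ∀ {n i N K} {v : Node ℓ n} {s} → Run (↓ v) N K s → Run (↓ child i v) N K (graft i s)
  graft-Run (announced {ν = ν} e) = announced (graftᴵ-cong {ν = ν} e)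
  graft-Run (positive p r) = positive (child≼ p) (graft-Run r)
  graft-Run (negative p r) = negative (λ { (child≼ q) → p q }) (graft-Run r)

  -- Truncated subtraction does no harm: if n ≤ b then there are no nodes of depth b.
  level : ∀ n b → Strategy (n ∸ b) → List (Node ℓ n × Strategy n)
  level zero    zero    s = []
  level (suc n) zero    s = (root , s) ∷ []
  level zero    (suc b) s = []
  level (suc n) (suc b) s =
    cartesianProductWith (λ i (v , t) → child i v , graft i t) (allFin ℓ) (level n b s)

  length-level : ∀ n b s → length (level n b s) ≤ ℓ ^ b
  length-level zero    zero    s = z≤n
  length-level (suc n) zero    s = ℕ.≤-refl
  length-level zero    (suc b) s = z≤n
  length-level (suc n) (suc b) s = begin
    length (level (suc n) (suc b) s)
      ≡⟨ length-cartesianProductWith _ (allFin ℓ) (level n b s) ⟩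
    length (allFin ℓ) * length (level n b s)
      ≡⟨ cong (_* length (level n b s)) (length-tabulate {n = ℓ} (λ i → i)) ⟩
    ℓ * length (level n b s)
      ≤⟨ ℕ.*-monoʳ-≤ ℓ (length-level n b s) ⟩
    ℓ ^ suc b ∎
    where open ℕ.≤-Reasoning

  -- Stripping from `x` the path from the root to `v` leaves a node `u` of the subtree above `v`;
  -- `graft-Run` carries the run on `u` back along this path.
  level-hit : ∀ {n N K} b {s v t} {x : Node ℓ n} →
    (∀ u → depth u + b ≤ depth x → Run (↓ u) N K s) →
    (v , t) ∈ˡ level n b s → v ≼ x → Run (↓ x) N K t
  level-hit {suc n} zero {x = x} hyp (here refl) _ = hyp x (ℕ.≤-reflexive (ℕ.+-identityʳ _))
  level-hit {suc n} (suc b) {s} hyp vt∈ v≼x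
    with _ , _ , _ , vt∈′ , refl ← ∈-cartesianProductWith⁻ _ (allFin ℓ) (level n b s) vt∈
    with child≼ v≼x′ ← v≼x
    = graft-Run (level-hit b
        (λ u p → hyp u (ℕ.≤-trans (ℕ.≤-reflexive (ℕ.+-suc (depth u) b)) (s≤s p))) vt∈′ v≼x′)

  -- Otherwise the ancestor of `x` at depth `b` would be in the list and below `x`.
  level-miss : ∀ {n} b {s} {x : Node ℓ n} →
    (∀ {v t} → (v , t) ∈ˡ level n b s → ¬ v ≼ x) → depth x < b
  level-miss {suc n} zero    miss = contradiction root≼ (miss (here refl))
  level-miss {suc n} (suc b) {x = root}      miss = s≤s z≤n
  level-miss {suc n} (suc b) {x = child i x} miss = s≤s (level-miss b λ vt∈ v≼x →
    miss (∈-cartesianProductWith⁺ _ (∈-allFin i) vt∈) (child≼ v≼x))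

  -- The value at height 0 is a default: for `n ∸ b = 0` the list `level n b` is empty.
  ↓root : ∀ n → Ideal n
  ↓root zero    = ∅
  ↓root (suc n) = ↓ root

  exhaust : ∀ n → ℕ → Strategy n
  exhaust n zero    = announce ∅
  exhaust n (suc b) = scan (level n b (announce (↓root (n ∸ b)))) (exhaust n b)

  -- Levels are queried from depth `b ∸ 1` towards the root, so the first positive answer is at the
  -- greatest element of `μ` and already identifies it.
  exhaust-Run : ∀ n b (μ : Ideal n) → height μ ≤ b → Run μ (geometric ℓ b) 1 (exhaust n b)
  exhaust-Run n zero    ∅ _ = announced ((λ p → p) , (λ p → p))
  exhaust-Run n (suc b) μ μ≤b = Run-mono
    (ℕ.≤-trans (ℕ.+-monoˡ-≤ (geometric ℓ b) (length-level n b _))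
      (ℕ.≤-reflexive (sym (geometric-suc ℓ b))))
    ℕ.≤-refl
    (scan-Run (level n b _) (hit μ μ≤b) λ none → exhaust-Run n b μ (miss μ none))
    where
    root-Run : ∀ {n} (u : Node ℓ n) → depth u ≤ 0 → Run (↓ u) (geometric ℓ b) 0 (announce (↓root n))
    root-Run root _ = announced ((λ p → p) , (λ p → p))

    hit : ∀ μ → height μ ≤ suc b → ∀ {v s} → (v , s) ∈ˡ level n b (announce (↓root (n ∸ b))) →
      v ∈ μ → Run μ (geometric ℓ b) 0 s
    -- The hit has depth `b` and `x` has depth at most `b`, so the node `u` left in the subtree is
    -- its root.
    hit (↓ x) (s≤s x≤b) = level-hit b λ u p → root-Run u
      (ℕ.+-cancelʳ-≤ b (depth u) 0 (ℕ.≤-trans p x≤b))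

    miss : ∀ μ → (∀ {v s} → (v , s) ∈ˡ level n b (announce (↓root (n ∸ b))) → ¬ v ∈ μ) →
      height μ ≤ b
    miss ∅     none = z≤n
    miss (↓ x) none = level-miss b none

  -- The block heights are bs from the root upwards, and c for the last block.
  blockSearch : ℕ → List ℕ → ∀ n → Strategy n
  blockSearch c []       n = exhaust n c
  blockSearch c (b ∷ bs) n = scan (level n b (blockSearch c bs (n ∸ b))) (exhaust n b)

  -- After the first level either outcome fits in the same remaining allowance: a hit leaves the
  -- other blocks, and a miss leaves the first block, whose exhaustion costs at most `geometric ℓ c`
  -- because `b ≤ c`.
  blockSearch-Run : ∀ {c bs n} → All (_≤ c) bs → n ∸ sum bs ≤ c → (μ : Ideal n) →
    Run μ (sum (map (ℓ ^_) bs) + geometric ℓ c) (suc (length bs)) (blockSearch c bs n)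
  blockSearch-Run {c} {[]} {n} [] n≤c μ = exhaust-Run n c μ (ℕ.≤-trans (height≤n μ) n≤c)
  blockSearch-Run {c} {b ∷ bs} {n} (b≤c ∷ bs≤c) n≤c μ = Run-mono
    (ℕ.≤-trans (ℕ.+-monoˡ-≤ N (length-level n b _))
      (ℕ.≤-reflexive (sym (ℕ.+-assoc (ℓ ^ b) _ _))))
    ℕ.≤-refl
    (scan-Run (level n b _) (hit μ) λ none → Run-mono
      (ℕ.≤-trans (geometric-mono ℓ b≤c) (ℕ.m≤n+m _ _))
      (s≤s z≤n)
      (exhaust-Run n b μ (miss μ none)))
    where
    N = sum (map (ℓ ^_) bs) + geometric ℓ c

    hit : ∀ μ → ∀ {v s} → (v , s) ∈ˡ level n b (blockSearch c bs (n ∸ b)) →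
      v ∈ μ → Run μ N (suc (length bs)) s
    hit (↓ x) = level-hit b λ u _ → blockSearch-Run bs≤c
      (ℕ.≤-trans (ℕ.≤-reflexive (ℕ.∸-+-assoc n b (sum bs))) n≤c) (↓ u)

    miss : ∀ μ → (∀ {v s} → (v , s) ∈ˡ level n b (blockSearch c bs (n ∸ b)) → ¬ v ∈ μ) →
      height μ ≤ b
    miss ∅     none = z≤n
    miss (↓ x) none = level-miss b none

  solvable-f : ∀ k .{{_ : NonZero k}} n → Solvable {n} k (f k ℓ n)
  -- From the root upwards the blocks belong to `j = 1, ..., k` and then `j = 0`. The last height
  -- `c` is thus the largest, and by `hermite` it is exactly what the others leave of `n`.
  solvable-f (suc k) n = blockSearch c bs n , λ μ → Run⇒bounds
    (Run-mono (ℕ.≤-reflexive cost) (s≤s (ℕ.≤-reflexive (length-applyUpTo block k)))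
      (blockSearch-Run
        (All.applyUpTo⁺₂ block k λ i → ⌈/⌉-mono (suc k) (ℕ.m∸n≤m n (suc i)))
        (ℕ.≤-trans (ℕ.∸-monoˡ-≤ (sum bs) (ℕ.≤-reflexive (sym (hermite n k))))
          (ℕ.≤-reflexive (ℕ.m+n∸n≡m c (sum bs))))
        μ))
    where
    block : ℕ → ℕ
    block i = ⌈ n ∸ suc i / suc k ⌉
    c  = ⌈ n / suc k ⌉
    bs = applyUpTo block k

    cost : sum (map (ℓ ^_) bs) + geometric ℓ c ≡ f (suc k) ℓ n
    cost = trans (ℕ.+-comm _ (geometric ℓ c))
      (cong (λ xs → geometric ℓ c + sum xs) (map-applyUpTo block (ℓ ^_) k))

  minimum : ∀ k .{{_ : NonZero k}} n → ∃ (Is𝒒 k (𝒯 ℓ n))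
  minimum k n = least (solvable? (nodes n) ∈-nodes k) (f k ℓ n) (solvable-f k n)

-- The factor `ℓ` makes up for the leaves numbering only `ℓ ^ (n ∸ 1)`, and enters the power since
-- `ℓ ≤ ℓ ^ k`; the factor 2 comes from `1 + N ≤ 2 * N` for positive `N`.
ℓ^n≤[2ℓN]^k : ∀ ℓ .{{_ : NonZero ℓ}} k .{{_ : NonZero k}} n .{{_ : NonZero n}} {N} →
  HiddenIdeal.Solvable (𝒯 ℓ n) k N → ℓ ^ n ≤ (2 * ℓ * N) ^ k
ℓ^n≤[2ℓN]^k ℓ (suc k) (suc n) {N} solvable with N | Tree.1+ℓ^n≤[1+N]^K ℓ {n} solvable
... | zero  | bound = contradiction
  (ℕ.≤-trans bound (ℕ.≤-reflexive (ℕ.^-zeroˡ (suc k))))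
  (ℕ.<⇒≱ (s≤s (ℕ.m^n>0 ℓ n)))
... | suc N | bound = begin
  ℓ * ℓ ^ n                            ≤⟨ ℕ.*-monoʳ-≤ ℓ (ℕ.<⇒≤ bound) ⟩
  ℓ * suc (suc N) ^ suc k              ≤⟨ ℕ.*-monoˡ-≤ (suc (suc N) ^ suc k) (ℕ.m≤m*n ℓ (ℓ ^ k) {{ℕ.m^n≢0 ℓ k}}) ⟩
  ℓ ^ suc k * suc (suc N) ^ suc k      ≡⟨ ^-distribʳ-* ℓ (suc (suc N)) (suc k) ⟨
  (ℓ * suc (suc N)) ^ suc k            ≤⟨ ℕ.^-monoˡ-≤ (suc k) (ℕ.*-monoʳ-≤ ℓ 2+N≤2*[1+N]) ⟩
  (ℓ * (2 * suc N)) ^ suc k            ≡⟨ cong (_^ suc k) (ℕ.*-assoc ℓ 2 (suc N)) ⟨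
  (ℓ * 2 * suc N) ^ suc k              ≡⟨ cong (λ x → (x * suc N) ^ suc k) (ℕ.*-comm ℓ 2) ⟩
  (2 * ℓ * suc N) ^ suc k              ∎
  where
  open ℕ.≤-Reasoning
  2+N≤2*[1+N] : suc (suc N) ≤ 2 * suc N
  2+N≤2*[1+N] = s≤s (ℕ.≤-trans (ℕ.≤-reflexive (ℕ.+-comm 1 N)) (ℕ.+-monoʳ-≤ N (s≤s z≤n)))

-- By `geometric≤` the first sum counts as one more term of size at most `ℓ ^ c`, which makes `k`
-- such terms; rounding `c` down to `n / k` costs the factor `ℓ`.
f≤ : ∀ k .{{_ : NonZero k}} ℓ .{{_ : NonZero ℓ}} → 2 ≤ ℓ → ∀ n → f k ℓ n ≤ k * ℓ * ℓ ^ (n / k)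
f≤ (suc k) ℓ 2≤ℓ n = begin
  f (suc k) ℓ n                          ≤⟨ ℕ.+-mono-≤ (geometric≤ ℓ 2≤ℓ c) (sum-applyUpTo-≤ _ k λ i →
                                              ℕ.^-monoʳ-≤ ℓ (⌈/⌉-mono (suc k) (ℕ.m∸n≤m n (suc i)))) ⟩
  suc k * ℓ ^ c                          ≤⟨ ℕ.*-monoʳ-≤ (suc k) (ℕ.^-monoʳ-≤ ℓ (⌈/⌉≤ n (suc k))) ⟩
  suc k * (ℓ * ℓ ^ (n / suc k))          ≡⟨ ℕ.*-assoc (suc k) ℓ _ ⟨
  suc k * ℓ * ℓ ^ (n / suc k)            ∎
  where
  open ℕ.≤-Reasoning
  c = ⌈ n / suc k ⌉

-- Supplies the integer `e = ℓ ^ (n / k)` for `≤scaled-root`.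
[ℓ^[n/k]]^k≤ℓ^n : ∀ ℓ .{{_ : NonZero ℓ}} n k .{{_ : NonZero k}} → (ℓ ^ (n / k)) ^ k ≤ ℓ ^ n
[ℓ^[n/k]]^k≤ℓ^n ℓ n k = ℕ.≤-trans (ℕ.≤-reflexive (ℕ.^-*-assoc ℓ (n / k) k))
  (ℕ.^-monoʳ-≤ ℓ (m/n*n≤m n k))

-- Comparison with the real numbers ℓ ^[ n / k ]

fromℚᵘ-homo-* : ∀ p q → fromℚᵘ p ℚ.* fromℚᵘ q ≡ fromℚᵘ (p ℚᵘ.* q)
fromℚᵘ-homo-* p q = ℚ.toℚᵘ-injective (begin
  toℚᵘ (fromℚᵘ p ℚ.* fromℚᵘ q)            ≈⟨ ℚ.toℚᵘ-homo-* (fromℚᵘ p) (fromℚᵘ q) ⟩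
  toℚᵘ (fromℚᵘ p) ℚᵘ.* toℚᵘ (fromℚᵘ q)    ≈⟨ ℚᵘ.*-cong (ℚ.toℚᵘ-fromℚᵘ p) (ℚ.toℚᵘ-fromℚᵘ q) ⟩
  p ℚᵘ.* q                                ≈⟨ ℚ.toℚᵘ-fromℚᵘ (p ℚᵘ.* q) ⟨
  toℚᵘ (fromℚᵘ (p ℚᵘ.* q))                ∎)
  where open ℚᵘ.≃-Reasoning

fromℚᵘ-mono-≤ : ∀ {p q} → p ℚᵘ.≤ q → fromℚᵘ p ℚ.≤ fromℚᵘ q
fromℚᵘ-mono-≤ {p} {q} p≤q = ℚ.toℚᵘ-cancel-≤ (begin
  toℚᵘ (fromℚᵘ p)  ≃⟨ ℚ.toℚᵘ-fromℚᵘ p ⟩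
  p                ≤⟨ p≤q ⟩
  q                ≃⟨ ℚ.toℚᵘ-fromℚᵘ q ⟨
  toℚᵘ (fromℚᵘ q)  ∎)
  where open ℚᵘ.≤-Reasoning

fromℚᵘ-mono-< : ∀ {p q} → p ℚᵘ.< q → fromℚᵘ p ℚ.< fromℚᵘ q
fromℚᵘ-mono-< {p} {q} p<q = ℚ.toℚᵘ-cancel-< (begin-strict
  toℚᵘ (fromℚᵘ p)  ≃⟨ ℚ.toℚᵘ-fromℚᵘ p ⟩
  p                <⟨ p<q ⟩
  q                ≃⟨ ℚ.toℚᵘ-fromℚᵘ q ⟨
  toℚᵘ (fromℚᵘ q)  ∎)
  where open ℚᵘ.≤-Reasoning

ι : ℕ → ℚ
ι n = pos n ℚ./ 1

ι-mono-≤ : ∀ {m n} → m ≤ n → ι m ℚ.≤ ι n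
ι-mono-≤ {m} {n} m≤n = fromℚᵘ-mono-≤ {mkℚᵘ (pos m) 0} {mkℚᵘ (pos n) 0}
  (*≤* (ℤ.*-monoʳ-≤-nonNeg (pos 1) (ℤ.+≤+ m≤n)))

ι≥0 : ∀ n → 0ℚ ℚ.≤ ι n
ι≥0 n = ι-mono-≤ {0} {n} z≤n

/-pos : ∀ m n .{{_ : NonZero m}} .{{_ : NonZero n}} → 0ℚ ℚ.< pos m ℚ./ n
/-pos m n = ℚ.positive⁻¹ _ {{ℚ.normalize-pos m n}}

ι-homo-* : ∀ m n → ι (m * n) ≡ ι m ℚ.* ι n
ι-homo-* m n = sym (trans (fromℚᵘ-homo-* (mkℚᵘ (pos m) 0) (mkℚᵘ (pos n) 0))
  (cong (ℚ._/ 1) (sym (ℤ.pos-* m n))))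

ι-homo-^ : ∀ m n → ι (m ^ n) ≡ ι m ^ℚ n
ι-homo-^ m zero    = refl
ι-homo-^ m (suc n) = trans (ι-homo-* m (m ^ n)) (cong (ι m ℚ.*_) (ι-homo-^ m n))

*-mono-≤-nonNeg : ∀ {p q r s} → 0ℚ ℚ.≤ p → 0ℚ ℚ.≤ r → p ℚ.≤ q → r ℚ.≤ s → p ℚ.* r ℚ.≤ q ℚ.* s
*-mono-≤-nonNeg {p} {q} {r} {s} 0≤p 0≤r p≤q r≤s = ℚ.≤-trans
  (ℚ.*-monoʳ-≤-nonNeg r {{ℚ.nonNegative 0≤r}} p≤q)
  (ℚ.*-monoˡ-≤-nonNeg q {{ℚ.nonNegative (ℚ.≤-trans 0≤p p≤q)}} r≤s)

^-nonNeg : ∀ {p} → 0ℚ ℚ.≤ p → ∀ n → 0ℚ ℚ.≤ p ^ℚ n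
^-nonNeg 0≤p zero    = ℚ.nonNegative⁻¹ 1ℚ
^-nonNeg {p} 0≤p (suc n) = subst (ℚ._≤ p ^ℚ suc n) (ℚ.*-zeroʳ p)
  (ℚ.*-monoˡ-≤-nonNeg p {{ℚ.nonNegative 0≤p}} (^-nonNeg 0≤p n))

^-mono-≤-nonNeg : ∀ {p q} → 0ℚ ℚ.≤ p → p ℚ.≤ q → ∀ n → p ^ℚ n ℚ.≤ q ^ℚ n
^-mono-≤-nonNeg 0≤p p≤q zero    = ℚ.≤-refl
^-mono-≤-nonNeg 0≤p p≤q (suc n) =
  *-mono-≤-nonNeg 0≤p (^-nonNeg 0≤p n) p≤q (^-mono-≤-nonNeg 0≤p p≤q n)

^-mono-<-pos : ∀ {p q} → 0ℚ ℚ.< p → p ℚ.< q → ∀ n → p ^ℚ suc n ℚ.< q ^ℚ suc n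
^-mono-<-pos {p} {q} 0<p p<q zero =
  subst₂ ℚ._<_ (sym (ℚ.*-identityʳ p)) (sym (ℚ.*-identityʳ q)) p<q
^-mono-<-pos {p} {q} 0<p p<q (suc n) = ℚ.<-trans
  (ℚ.*-monoʳ-<-pos p {{ℚ.positive 0<p}} (^-mono-<-pos 0<p p<q n))
  (ℚ.*-monoˡ-<-pos (q ^ℚ suc n) {{ℚ.positive 0<qⁿ}} p<q)
  where
  0<qⁿ : 0ℚ ℚ.< q ^ℚ suc n
  0<qⁿ = ℚ.≤-<-trans (^-nonNeg (ℚ.<⇒≤ 0<p) (suc n)) (^-mono-<-pos 0<p p<q n)

1/ℕ : (n : ℕ) .{{_ : NonZero n}} → ℝ⁺
1/ℕ n = mkℝ⁺ (fromℚ (pos 1 ℚ./ n)) (/-pos 1 n)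

1/n*ι[n*m] : ∀ n .{{_ : NonZero n}} m → (pos 1 ℚ./ n) ℚ.* ι (n * m) ≡ ι m
1/n*ι[n*m] n@(suc n-1) m = trans (fromℚᵘ-homo-* (mkℚᵘ (pos 1) n-1) (mkℚᵘ (pos (n * m)) 0))
  (ℚ.fromℚᵘ-cong {mkℚᵘ (pos 1) n-1 ℚᵘ.* mkℚᵘ (pos (n * m)) 0} {mkℚᵘ (pos m) 0} (*≡* (begin
    pos 1 ℤ.* pos (n * m) ℤ.* pos 1  ≡⟨ ℤ.*-identityʳ _ ⟩
    pos 1 ℤ.* pos (n * m)            ≡⟨ ℤ.*-identityˡ _ ⟩
    pos (n * m)                      ≡⟨ cong pos (ℕ.*-comm n m) ⟩
    pos (m * n)                      ≡⟨ cong (λ x → pos (m * x)) (ℕ.*-identityʳ n) ⟨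
    pos (m * (n * 1))                ≡⟨ ℤ.pos-* m (n * 1) ⟩
    pos m ℤ.* pos (n * 1)            ∎)))
  where open ≡-Reasoning

-- A rational whose power is below `x` is below `a * N`, as powers are monotone; a factor below
-- `1 / a` then brings the product below `N`.
scaled-root≤ : ∀ a .{{_ : NonZero a}} k .{{_ : NonZero k}} x .{{_ : NonZero x}} {N} →
  x ≤ (a * N) ^ k → value (1/ℕ a *⁺ nthRoot k (fromℕ⁺ x)) ≤ᴿ fromℕ N
scaled-root≤ a (suc k) x {N} x≤ {p} (r , b , 0<r , 0<b , r<1/a , (t , 0<t , tᵏ<x , b<t) , p<rb) =
  begin-strict
    p                              <⟨ p<rb ⟩
    r ℚ.* b                        ≤⟨ *-mono-≤-nonNeg (ℚ.<⇒≤ 0<r) (ℚ.<⇒≤ 0<b) (ℚ.<⇒≤ r<1/a) (ℚ.<⇒≤ (ℚ.<-trans b<t t<aN)) ⟩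
    (pos 1 ℚ./ a) ℚ.* ι (a * N)    ≡⟨ 1/n*ι[n*m] a N ⟩
    ι N                            ∎
  where
  open ℚ.≤-Reasoning
  t<aN : t ℚ.< ι (a * N)
  t<aN = ℚ.≰⇒> λ aN≤t → ℚ.<-irrefl refl (ℚ.<-≤-trans tᵏ<x (begin
    ι x                      ≤⟨ ι-mono-≤ x≤ ⟩
    ι ((a * N) ^ suc k)      ≡⟨ ι-homo-^ (a * N) (suc k) ⟩
    ι (a * N) ^ℚ suc k       ≤⟨ ^-mono-≤-nonNeg (ι≥0 (a * N)) aN≤t (suc k) ⟩
    t ^ℚ suc k               ∎))

ι[2c]*e/2 : ∀ c e → ι (2 * c) ℚ.* (pos e ℚ./ 2) ≡ ι (c * e)
ι[2c]*e/2 c e = trans (fromℚᵘ-homo-* (mkℚᵘ (pos (2 * c)) 0) (mkℚᵘ (pos e) 1))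
  (ℚ.fromℚᵘ-cong {mkℚᵘ (pos (2 * c)) 0 ℚᵘ.* mkℚᵘ (pos e) 1} {mkℚᵘ (pos (c * e)) 0} (*≡* (begin
    pos (2 * c) ℤ.* pos e ℤ.* pos 1  ≡⟨ ℤ.*-identityʳ _ ⟩
    pos (2 * c) ℤ.* pos e            ≡⟨ ℤ.pos-* (2 * c) e ⟨
    pos (2 * c * e)                  ≡⟨ cong pos (ℕ.*-assoc 2 c e) ⟩
    pos (2 * (c * e))                ≡⟨ cong pos (ℕ.*-comm 2 (c * e)) ⟩
    pos (c * e * 2)                  ≡⟨ ℤ.pos-* (c * e) 2 ⟩
    pos (c * e) ℤ.* pos 2            ∎)))
  where open ≡-Reasoning

-- The cuts are open, so the scale is enlarged from c to 2c + 1 and the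
-- rationals exhibited below it and below the root are 2c and e / 2.
≤scaled-root : ∀ c .{{_ : NonZero c}} k .{{_ : NonZero k}} x .{{_ : NonZero x}} e .{{_ : NonZero e}} {N} →
  e ^ k ≤ x → N ≤ c * e → fromℕ N ≤ᴿ value (fromℕ⁺ (suc (2 * c)) *⁺ nthRoot k (fromℕ⁺ x))
≤scaled-root c (suc k) x e {N} eᵏ≤x N≤ce {p} p<N =
  ι (2 * c) , pos e ℚ./ 2 , /-pos (2 * c) 1 {{ℕ.m*n≢0 2 c}} , /-pos e 2 , 2c<1+2c , root∋e/2 (ℚ.<-dense e/2<e) ,
  (begin-strict
    p                            <⟨ p<N ⟩
    ι N                          ≤⟨ ι-mono-≤ N≤ce ⟩
    ι (c * e)                    ≡⟨ ι[2c]*e/2 c e ⟨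
    ι (2 * c) ℚ.* (pos e ℚ./ 2)  ∎)
  where
  open ℚ.≤-Reasoning
  2c<1+2c : ι (2 * c) ℚ.< ι (suc (2 * c))
  2c<1+2c = fromℚᵘ-mono-< {mkℚᵘ (pos (2 * c)) 0} {mkℚᵘ (pos (suc (2 * c))) 0}
    (*<* (ℤ.*-monoʳ-<-pos (pos 1) (ℤ.+<+ (ℕ.n<1+n (2 * c)))))

  e/2<e : pos e ℚ./ 2 ℚ.< ι e
  e/2<e = fromℚᵘ-mono-< {mkℚᵘ (pos e) 1} {mkℚᵘ (pos e) 0}
    (*<* (subst₂ ℤ._<_ (ℤ.pos-* e 1) (ℤ.pos-* e 2)
      (ℤ.+<+ (ℕ.*-monoʳ-< e (s≤s (s≤s z≤n))))))

  -- Both inequalities in the root are strict, so the witness `t` has to lie strictly between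
  -- `e / 2` and `e`.
  root∋e/2 : (∃ λ t → pos e ℚ./ 2 ℚ.< t × t ℚ.< ι e) →
    ∃ λ t → 0ℚ ℚ.< t × t ^ℚ suc k ℚ.< ι x × pos e ℚ./ 2 ℚ.< t
  root∋e/2 (t , e/2<t , t<e) = t , 0<t , (begin-strict
      t ^ℚ suc k      <⟨ ^-mono-<-pos 0<t t<e k ⟩
      ι e ^ℚ suc k    ≡⟨ ι-homo-^ e (suc k) ⟨
      ι (e ^ suc k)   ≤⟨ ι-mono-≤ eᵏ≤x ⟩
      ι x             ∎) , e/2<t
    where
    0<t : 0ℚ ℚ.< t
    0<t = ℚ.<-trans (/-pos e 2) e/2<t

-- The constants and the asymptotic statements

theoremB : (k ℓ : ℕ) .{{_ : NonZero k}} .{{_ : NonZero ℓ}} → 2 ≤ ℓ →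
    ∃ λ (q : ℕ → ℕ) →
    (∀ n .{{_ : NonZero n}} → Is𝒒 k (𝒯 ℓ n) (q n))
    × (∃₂ λ (m M : ℝ⁺) → ∀ n .{{_ : NonZero n}} →
    value (m *⁺ ℓ ^[ n / k ]) ≤ᴿ fromℕ (q n)
    × fromℕ (q n) ≤ᴿ fromℕ (f k ℓ n)
    × fromℕ (f k ℓ n) ≤ᴿ value (M *⁺ ℓ ^[ n / k ]))
    × (q =Θ λ n → ℓ ^[ n / k ])
    × (f k ℓ =Θ λ n → ℓ ^[ n / k ])
theoremB k ℓ 2≤ℓ =
  q
    , (λ n → is𝒒 n)
    , (m , M , λ n → lower n , middle n , upper n)
    -- The threshold is 1: at `n = 0` there are no nodes, so `q` is 0 and the lower bound fails. As
    -- `q` lies below `f k ℓ`, the same `m` and `M` serve both functions.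
    , (m , M , 1 , λ { n@(suc _) _ → lower n , λ p<q → upper n (middle n p<q) })
    , (m , M , 1 , λ { n@(suc _) _ → (λ p<mh → middle n (lower n p<mh)) , upper n })
  where
  instance
    2*ℓ≢0 : NonZero (2 * ℓ)
    2*ℓ≢0 = ℕ.m*n≢0 2 ℓ
    k*ℓ≢0 : NonZero (k * ℓ)
    k*ℓ≢0 = ℕ.m*n≢0 k ℓ

  q : ℕ → ℕ
  q n = proj₁ (Tree.minimum ℓ k n)

  is𝒒 : ∀ n → Is𝒒 k (𝒯 ℓ n) (q n)
  is𝒒 n = proj₂ (Tree.minimum ℓ k n)

  m M : ℝ⁺
  -- `m` inverts the factor in `ℓ^n≤[2ℓN]^k`; `M` is the factor `k * ℓ` of `f≤`, enlarged as
  -- `≤scaled-root` requires.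
  m = 1/ℕ (2 * ℓ)
  M = fromℕ⁺ (suc (2 * (k * ℓ)))

  lower : ∀ n .{{_ : NonZero n}} → value (m *⁺ ℓ ^[ n / k ]) ≤ᴿ fromℕ (q n)
  lower n = scaled-root≤ (2 * ℓ) k (ℓ ^ n) {{ℕ.m^n≢0 ℓ n}} (ℓ^n≤[2ℓN]^k ℓ k n (proj₁ (is𝒒 n)))

  middle : ∀ n → fromℕ (q n) ≤ᴿ fromℕ (f k ℓ n)
  middle n p<q = ℚ.<-≤-trans p<q (ι-mono-≤ (proj₂ (is𝒒 n) (f k ℓ n) (Tree.solvable-f ℓ k n)))

  upper : ∀ n → fromℕ (f k ℓ n) ≤ᴿ value (M *⁺ ℓ ^[ n / k ])
  upper n = ≤scaled-root (k * ℓ) k (ℓ ^ n) {{ℕ.m^n≢0 ℓ n}} (ℓ ^ (n / k)) {{ℕ.m^n≢0 ℓ (n / k)}}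
    ([ℓ^[n/k]]^k≤ℓ^n ℓ n k) (f≤ k ℓ 2≤ℓ n)
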